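{- Let $\Gamma_1, \Gamma_2, \ldots, \Gamma_k$ be $0$- or $1$-dimensional flag simplicial complexes (i.e., triangle-free graphs) such that for each $i$, either $\Gamma_i$ is bipartite or $\Gamma_i - e$ is bipartite for some edge $e$ of $\Gamma_i$. Let $\Gamma = \Gamma_1 * \Gamma_2 * \cdots * \Gamma_k$, where $*$ denotes the simplicial join. Then for every full-dimensional Cohen-Macaulay subcomplex $\Delta$ of $\Gamma$, $f(\Delta)$ is the $f$-vector of some balanced simplicial complex of the same dimension as $\Delta$.
   Context: All simplicial complexes are finite: a simplicial complex $\Delta$ on a finite vertex set $V$ is a set of subsets of $V$ (called faces) closed under inclusion. The dimension of a face $\gamma$ is $|\gamma|-1$, and $\dim(\Delta)$ is the maximum dimension of a face. If $\dim \Delta = d-1$, the $f$-vector is $f(\Delta) = (f_{ -1}, f_0, \ldots, f_{d-1})$, where $f_i$ is the number of $i$-dimensional faces; the $h$-vector $(h_0,\ldots,h_d)$ is defined by $\sum_{i=0}^d h_i x^i = \sum_{i=0}^d f_{i-1} x^i (1-x)^{d-i}$. The simplicial join of complexes on disjoint vertex sets is $\Delta_1 * \Delta_2 = \{\tau_1 \cup \tau_2 : \tau_1 \in \Delta_1, \tau_2 \in \Delta_2\}$. A complex is flag if every clique in its $1$-skeleton (viewed as a graph) is a face; a $0$- or $1$-dimensional complex is identified with a graph, and it is flag if and only if this graph has no triangles. $\Gamma_i - e$ denotes the graph obtained by deleting the edge $e$ (keeping its endpoints). A subcomplex $\Delta$ of $\Gamma$ is full-dimensional if $\dim \Delta = \dim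 \Gamma$. A proper $k$-coloring of a complex on $V$ is a map $\kappa: V \to \{1,\dots,k\}$ such that distinct vertices contained in a common face receive different values. A $(d-1)$-dimensional complex is balanced if it has a proper $d$-coloring. Fix a field $\mathbf{k}$ of characteristic zero. For a $(d-1)$-dimensional complex $\Delta$ on $V$, the Stanley-Reisner ring is $\mathbf{k}[\Delta] = \mathbf{k}[x_v : v \in V]/I_\Delta$ (graded by $\deg x_v = 1$), where $I_\Delta$ is generated by the squarefree monomials $x_{v_1}\cdots x_{v_r}$ with $\{v_1,\ldots,v_r\} \notin \Delta$. A linear system of parameters (l.s.o.p.) is a sequence $\theta_1,\ldots,\theta_d$ of elements of $\mathbf{k}[\Delta]_1$ such that $\mathbf{k}[\Delta]/(\theta_1,\ldots,\theta_d)$ is finite-dimensional over $\mathbf{k}$. $\Delta$ is Cohen-Macaulay (over $\mathbf{k}$) if for some (equivalently, every) l.s.o.p. one has $\dim_{\mathbf{k}} (\mathbf{k}[\Delta]/(\theta_1,\ldots,\theta_d))_i = h_i$ for all $0 \le i \le d$. -}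

module Defs where

open import Level using (_⊔_; 0ℓ)
open import Algebra.Apartness.Bundles using (HeytingField; HeytingCommutativeRing)
open import Algebra.Bundles using (CommutativeRing)
open import Algebra.Definitions.RawMonoid using () renaming (_×_ to multiple)
open import Data.Bool.Base using (if_then_else_)
open import Data.Fin.Base using (Fin; zero; suc; toℕ; _↑ˡ_; _↑ʳ_)
open import Data.Fin.Subset using (Subset; inside; outside; _∈_; _⊆_; _∪_; ⁅_⁆; ∣_∣)
open import Data.Fin.Subset.Properties using (_⊆?_; ⊆-trans)
open import Data.Integer.Base as ℤ using (ℤ; +_; _⊖_; 0ℤ; 1ℤ)
import Data.Integer.Properties as ℤ
open import Data.List.Base as List using (List; []; _∷_; _++_)
open import Data.Nat.Base as ℕ using (ℕ; zero; suc)
import Data.Nat.Properties as ℕ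
open import Data.Nat.GeneralisedArithmetic using (fold)
open import Data.Product.Base using (∃; ∃-syntax; Σ-syntax; _×_; _,_; map₁)
open import Data.Vec.Base as Vec using (Vec; []; _∷_)
open import Data.Vec.Functional as Vector using (Vector)
open import Data.Vec.Properties as Vec using (≡-dec)
open import Function.Base using (_∘_)
open import Relation.Binary.PropositionalEquality
open import Relation.Nullary.Decidable as Dec using (does; yes; _×-dec_; ¬?)
open import Relation.Nullary.Negation using (¬_)
open import Relation.Unary as Unary using (Pred; Decidable; U)

-- The vertex set is Fin n.  As usual, an element of the vertex set need not
-- itself be a (0-dimensional) face.
record Complex (n : ℕ) : Set₁ where
  field
    Face   : Pred (Subset n) 0ℓ
    face?  : Decidable Face
    closed : ∀ {σ τ} → τ ⊆ σ → Face σ → Face τ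

open Complex public

dimFace : ∀ {n} → Subset n → ℤ
dimFace σ = ∣ σ ∣ ⊖ 1

-- dim Δ = δ; in particular Δ has at least one face.
HasDim : ∀ {n} → Complex n → ℤ → Set
HasDim Δ δ =
  (∃[ σ ] Face Δ σ × dimFace σ ≡ δ) × (∀ σ → Face Δ σ → dimFace σ ℤ.≤ δ)

_⊑_ : ∀ {n} → Complex n → Complex n → Set
Δ ⊑ Γ = ∀ σ → Face Δ σ → Face Γ σ

subsets : ∀ n → List (Subset n)
subsets zero    = [] ∷ []
subsets (suc n) =
  List.map (outside ∷_) (subsets n) ++ List.map (inside ∷_) (subsets n)

f : ∀ {n} → Complex n → ℤ → ℕ
f Δ i = List.length
  (List.filter (λ σ → face? Δ σ ×-dec (dimFace σ ℤ.≟ i)) (subsets _))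

-- (f₋₁ , f₀ , … , f_{d-1})
fVector : ∀ {n} (d : ℕ) → Complex n → Vec ℕ (suc d)
fVector d Δ = Vec.tabulate (λ j → f Δ (toℕ j ⊖ 1))

-- Integer polynomials in one variable x, given by their coefficients.
one : ℕ → ℤ
one zero    = 1ℤ
one (suc _) = 0ℤ

x·_ : (ℕ → ℤ) → ℕ → ℤ
(x· p) zero    = 0ℤ
(x· p) (suc i) = p i

[1-x]·_ : (ℕ → ℤ) → ℕ → ℤ
([1-x]· p) i = p i ℤ.- (x· p) i

-- xʲ (1 - x)ᵉ
xʲ[1-x]ᵉ : ℕ → ℕ → ℕ → ℤ
xʲ[1-x]ᵉ j e = fold (fold one [1-x]·_ e) x·_ j

-- h d Δ i is the coefficient of xⁱ in  Σ_{0≤j≤d} f_{j-1} xʲ (1 - x)^{d-j},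
-- where dim Δ = d - 1.
h : ∀ {n} (d : ℕ) → Complex n → ℕ → ℤ
h d Δ i = List.foldr ℤ._+_ 0ℤ
  (List.map (λ j → + f Δ (j ⊖ 1) ℤ.* xʲ[1-x]ᵉ j (d ℕ.∸ j) i) (List.upTo (suc d)))

ProperColoring : ∀ {n} (k : ℕ) → Complex n → (Fin n → Fin k) → Set
ProperColoring k Δ κ =
  ∀ σ → Face Δ σ → ∀ u v → u ∈ σ → v ∈ σ → u ≢ v → κ u ≢ κ v

Balanced : ∀ {n} → Complex n → Set
Balanced Δ = ∃[ d ] HasDim Δ (d ⊖ 1) × ∃ (ProperColoring d Δ)

-- Adjacency in the 1-skeleton, viewed as a graph on the 0-dimensional faces.
Adjacent : ∀ {n} → Complex n → Fin n → Fin n → Set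
Adjacent Δ u v = u ≢ v × Face Δ (⁅ u ⁆ ∪ ⁅ v ⁆)

Clique : ∀ {n} → Complex n → Subset n → Set
Clique Δ σ =
  (∀ v → v ∈ σ → Face Δ ⁅ v ⁆) ×
  (∀ u v → u ∈ σ → v ∈ σ → u ≢ v → Adjacent Δ u v)

Flag : ∀ {n} → Complex n → Set
Flag Δ = ∀ σ → Clique Δ σ → Face Δ σ

Bipartite : ∀ {n} → Complex n → Set
Bipartite {n} Γ =
  Σ[ κ ∈ (Fin n → Fin 2) ] (∀ u v → Adjacent Γ u v → κ u ≢ κ v)

-- Removing a face together with all faces containing it.  If Γ is a graph
-- and e an edge of it, only e is removed; its endpoints remain.
_∖_ : ∀ {n} → Complex n → Subset n → Complex n
Γ ∖ e = record
  { Face   = λ σ → Face Γ σ × ¬ (e ⊆ σ)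
  ; face?  = λ σ → face? Γ σ ×-dec ¬? (e ⊆? σ)
  ; closed = λ {σ} {τ} τ⊆σ (σ∈Γ , e⊈σ) →
      closed Γ τ⊆σ σ∈Γ , λ e⊆τ → e⊈σ (⊆-trans {i = e} {j = τ} {k = σ} e⊆τ τ⊆σ)
  }

AlmostBipartite : ∀ {n} → Complex n → Set
AlmostBipartite Γ =
  ∃[ u ] ∃[ v ] Adjacent Γ u v × Bipartite (Γ ∖ (⁅ u ⁆ ∪ ⁅ v ⁆))

⊆-++ˡ : ∀ {m n} (σ₁ τ₁ : Subset m) {σ₂ τ₂ : Subset n} →
        (σ₁ Vec.++ σ₂) ⊆ (τ₁ Vec.++ τ₂) → σ₁ ⊆ τ₁
⊆-++ˡ {n = n} σ₁ τ₁ {σ₂} {τ₂} σ⊆τ {x} x∈σ₁ = Vec.lookup⇒[]= x τ₁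
  (trans (sym (Vec.lookup-++ˡ τ₁ τ₂ x))
    (Vec.[]=⇒lookup (σ⊆τ (Vec.lookup⇒[]= (x ↑ˡ n) (σ₁ Vec.++ σ₂)
      (trans (Vec.lookup-++ˡ σ₁ σ₂ x) (Vec.[]=⇒lookup x∈σ₁))))))

⊆-++ʳ : ∀ {m n} (σ₁ τ₁ : Subset m) {σ₂ τ₂ : Subset n} →
        (σ₁ Vec.++ σ₂) ⊆ (τ₁ Vec.++ τ₂) → σ₂ ⊆ τ₂
⊆-++ʳ {m = m} σ₁ τ₁ {σ₂} {τ₂} σ⊆τ {x} x∈σ₂ = Vec.lookup⇒[]= x τ₂
  (trans (sym (Vec.lookup-++ʳ τ₁ τ₂ x))
    (Vec.[]=⇒lookup (σ⊆τ (Vec.lookup⇒[]= (m ↑ʳ x) (σ₁ Vec.++ σ₂)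
      (trans (Vec.lookup-++ʳ σ₁ σ₂ x) (Vec.[]=⇒lookup x∈σ₂))))))

-- The disjoint union of the vertex sets Fin m and Fin n is Fin (m + n), and
-- τ₁ ++ τ₂ is the union of τ₁ and τ₂ regarded as subsets of it.
_⋆_ : ∀ {m n} → Complex m → Complex n → Complex (m ℕ.+ n)
_⋆_ {m} {n} Δ₁ Δ₂ = record
  { Face = F ; face? = F? ; closed = F-closed }
  where
  F : Pred (Subset (m ℕ.+ n)) 0ℓ
  F σ = ∃[ τ₁ ] ∃[ τ₂ ] Face Δ₁ τ₁ × Face Δ₂ τ₂ × σ ≡ τ₁ Vec.++ τ₂

  F? : Decidable F
  F? σ with Vec.splitAt m σ
  ... | σ₁ , σ₂ , refl =
    Dec.map′ (λ (σ₁∈ , σ₂∈) → σ₁ , σ₂ , σ₁∈ , σ₂∈ , refl) split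
             (face? Δ₁ σ₁ ×-dec face? Δ₂ σ₂)
    where
    split : F (σ₁ Vec.++ σ₂) → Face Δ₁ σ₁ × Face Δ₂ σ₂
    split (τ₁ , τ₂ , τ₁∈ , τ₂∈ , eq) with Vec.++-injective σ₁ τ₁ eq
    ... | refl , refl = τ₁∈ , τ₂∈

  F-closed : ∀ {σ τ} → τ ⊆ σ → F σ → F τ
  F-closed {τ = τ} τ⊆σ (σ₁ , σ₂ , σ₁∈ , σ₂∈ , refl) with Vec.splitAt m τ
  ... | τ₁ , τ₂ , refl =
    τ₁ , τ₂ , closed Δ₁ (⊆-++ˡ τ₁ σ₁ τ⊆σ) σ₁∈ , closed Δ₂ (⊆-++ʳ τ₁ σ₁ τ⊆σ) σ₂∈ , refl

-- The complex {∅} on the empty vertex set, the unit of the join.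
｛∅｝ : Complex 0
｛∅｝ = record
  { Face = U ; face? = λ _ → yes _ ; closed = λ _ _ → _ }

total : ∀ {k} → Vector ℕ k → ℕ
total = Vector.foldr ℕ._+_ 0

join : ∀ {k} {n : Vector ℕ k} → (∀ i → Complex (n i)) → Complex (total n)
join {zero}  Γ = ｛∅｝
join {suc k} Γ = Γ zero ⋆ join (Γ ∘ suc)

-- Heyting fields are classically the same as fields, x # y meaning x ≠ y.
-- Decidable equality is not required.
module _ {c ℓ₁ ℓ₂} (K : HeytingField c ℓ₁ ℓ₂) where

  open HeytingField K hiding (_-_)

  CharZero : Set ℓ₁
  CharZero = ∀ n → ¬ (multiple +-rawMonoid (suc n) 1# ≈ 0#)
    where
    +-rawMonoid = CommutativeRing.+-rawMonoid
      (HeytingCommutativeRing.commutativeRing heytingCommutativeRing)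

  -- x₁^{a₁} ⋯ xₙ^{aₙ} is represented by its exponents (a₁ , … , aₙ).
  Monomial : ℕ → Set
  Monomial n = Vec ℕ n

  -- A formal sum of terms; a monomial may occur repeatedly or with
  -- coefficient zero, so equality is _≈ₚ_ below.
  Polynomial : ℕ → Set c
  Polynomial n = List (Carrier × Monomial n)

  module _ {n : ℕ} where

    coeff : Polynomial n → Monomial n → Carrier
    coeff []            m = 0#
    coeff ((a , t) ∷ p) m =
      if does (≡-dec ℕ._≟_ t m) then a + coeff p m else coeff p m

    infix 4 _≈ₚ_
    _≈ₚ_ : Polynomial n → Polynomial n → Set ℓ₁
    p ≈ₚ q = ∀ m → coeff p m ≈ coeff q m

    0ₚ : Polynomial n
    0ₚ = []

    infixl 6 _+ₚ_ _-ₚ_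
    infixl 7 _*ₚ_ _·ₚ_
    _+ₚ_ _-ₚ_ _*ₚ_ : Polynomial n → Polynomial n → Polynomial n
    p +ₚ q = p ++ q
    p -ₚ q = p ++ List.map (map₁ -_) q
    p *ₚ q = List.cartesianProductWith
      (λ (a , s) (b , t) → a * b , Vec.zipWith ℕ._+_ s t) p q

    _·ₚ_ : Carrier → Polynomial n → Polynomial n
    a ·ₚ p = List.map (map₁ (a *_)) p

    linearCombination : ∀ {m} → Vector Carrier m → Vector (Polynomial n) m → Polynomial n
    linearCombination a b = Vector.foldr _+ₚ_ 0ₚ (Vector.zipWith _·ₚ_ a b)

    Homogeneous : ℕ → Pred (Polynomial n) ℓ₁
    Homogeneous i p = ∀ m → Vec.sum m ≢ i → coeff p m ≈ 0#

    data ⟨_⟩ {g} (G : Pred (Polynomial n) g) : Pred (Polynomial n) (c ⊔ ℓ₁ ⊔ g) where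
      generator : ∀ {p} → G p → ⟨ G ⟩ p
      0∈        : ⟨ G ⟩ 0ₚ
      +-closed  : ∀ {p q} → ⟨ G ⟩ p → ⟨ G ⟩ q → ⟨ G ⟩ (p +ₚ q)
      *-closed  : ∀ q {p} → ⟨ G ⟩ p → ⟨ G ⟩ (q *ₚ p)
      ≈-closed  : ∀ {p q} → p ≈ₚ q → ⟨ G ⟩ p → ⟨ G ⟩ q

    -- b is a basis of the image of the subspace S in the quotient by J.
    record IsBasisMod {s j} (S : Pred (Polynomial n) s) (J : Pred (Polynomial n) j)
                      {m : ℕ} (b : Vector (Polynomial n) m) : Set (c ⊔ ℓ₁ ⊔ s ⊔ j) where
      field
        belongs     : ∀ l → S (b l)
        spans       : ∀ p → S p → ∃[ a ] J (p -ₚ linearCombination a b)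
        independent : ∀ a → J (linearCombination a b) → ∀ l → a l ≈ 0#

    HasDimensionMod : ∀ {s j} → Pred (Polynomial n) s → Pred (Polynomial n) j → ℕ →
                      Set (c ⊔ ℓ₁ ⊔ s ⊔ j)
    HasDimensionMod S J m = Σ[ b ∈ Vector (Polynomial n) m ] IsBasisMod S J b

    squarefreeMonomial : Subset n → Polynomial n
    squarefreeMonomial σ = (1# , Vec.map (if_then 1 else 0) σ) ∷ []

    -- I_Δ, so that 𝐤[Δ] consists of polynomials modulo StanleyReisnerIdeal Δ.
    StanleyReisnerIdeal : Complex n → Pred (Polynomial n) (c ⊔ ℓ₁)
    StanleyReisnerIdeal Δ = ⟨ (λ p → ∃[ σ ] ¬ Face Δ σ × p ≡ squarefreeMonomial σ) ⟩

    -- The preimage in 𝐤[x] of the ideal (θ₁ , … , θ_d) of 𝐤[Δ], so that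
    -- 𝐤[Δ]/(θ₁ , … , θ_d) consists of polynomials modulo ParameterIdeal Δ θ.
    ParameterIdeal : ∀ {d} → Complex n → Vector (Polynomial n) d → Pred (Polynomial n) (c ⊔ ℓ₁)
    ParameterIdeal Δ θ = ⟨ StanleyReisnerIdeal Δ Unary.∪ (λ p → ∃[ l ] p ≡ θ l) ⟩

    -- Elements of 𝐤[Δ]₁ are given by linear forms representing them.
    -- Here dim Δ = d - 1.
    IsLSOP : ∀ {d} → Complex n → Vector (Polynomial n) d → Set (c ⊔ ℓ₁)
    IsLSOP Δ θ = (∀ l → Homogeneous 1 (θ l)) × ∃ (HasDimensionMod U (ParameterIdeal Δ θ))

    CohenMacaulay : Complex n → Set (c ⊔ ℓ₁)
    CohenMacaulay Δ =
      ∃[ d ] HasDim Δ (d ⊖ 1) ×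
      Σ[ θ ∈ Vector (Polynomial n) d ] IsLSOP Δ θ ×
      (∀ i → i ℕ.≤ d →
        ∃[ m ] + m ≡ h d Δ i × HasDimensionMod (Homogeneous i) (ParameterIdeal Δ θ) m)

{-# OPTIONS --safe #-}
module Submission where

-- Fix Γᵢ and a face τ of the join of the other factors. The faces of Γᵢ that
-- together with τ form a face of Δ make up a triangle-free graph G, with N vertices and
-- E edges, say. Replace G by the graph on N vertices coloured alternately whose
-- edges are the first E pairs of vertices of different colour, ordered by their larger
-- endpoint: by Mantel's theorem E ≤ ⌊N²/4⌋, so there are enough such pairs.
-- The new graph depends monotonically on G, so this yields a complex
-- again; it has the same f-vector, and treating one factor after another makes all of
-- them properly coloured. Factors of dimension 0 need only one colour.

open import Defs
open import Algebra.Apartness.Bundles using (HeytingField)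
open import Data.Bool.Base using (if_then_else_)
open import Data.Fin.Base as Fin using (Fin; zero; suc; opposite; inject≤; _↑ˡ_; _↑ʳ_)
import Data.Fin.Properties as Fin
open import Data.Fin.Subset
  using (Subset; inside; outside; _∈_; _⊆_; _∪_; ⁅_⁆; ∣_∣) renaming (⊥ to ∅)
open import Data.Fin.Subset.Properties
open import Data.Integer.Base as ℤ using (+_; _⊖_)
import Data.Integer.Properties as ℤ
import Data.List.Base as List
import Data.List.Properties as List
open import Data.Nat.Base using (ℕ; zero; suc; _+_; _*_; _∸_; _⊓_; _≤_; _<_; z≤n; s≤s)
open import Data.Nat.Properties
open import Data.Nat.Tactic.RingSolver using (solve-∀)
open import Data.Product.Base using (∃; _×_; _,_; Σ-syntax; ∃-syntax; proj₁; proj₂)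
open import Data.Sum.Base using (_⊎_; inj₁; inj₂; [_,_]′)
open import Data.Unit.Base using (⊤; tt)
open import Data.Vec.Base as Vec using ([]; _∷_; here; there)
import Data.Vec.Properties as Vec
open import Data.Vec.Functional using (Vector)
open import Function.Base using (_∘_; id; case_of_)
open import Relation.Binary.PropositionalEquality
open import Relation.Nullary.Decidable using (Dec; yes; no; does; _×-dec_; ¬?)
open import Relation.Nullary.Negation using (¬_; contradiction)
open import Algebra.Properties.Semiring.Sum +-*-semiring
  using (sum; sum-cong-≗; ∑-distrib-+; *-distribˡ-sum; *-distribʳ-sum)

open ≤-Reasoning

⟦_⟧ : ∀ {p} {P : Set p} → Dec P → ℕ
⟦ P? ⟧ = if does P? then 1 else 0

module _ {p q} {P : Set p} {Q : Set q} where

  ⟦⟧-mono : (P → Q) → (P? : Dec P) (Q? : Dec Q) → ⟦ P? ⟧ ≤ ⟦ Q? ⟧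
  ⟦⟧-mono P⇒Q (no _)  _       = z≤n
  ⟦⟧-mono P⇒Q (yes p) (yes _) = ≤-refl
  ⟦⟧-mono P⇒Q (yes p) (no ¬q) = contradiction (P⇒Q p) ¬q

  ⟦⟧-difference : (P → Q) → (P? : Dec P) (Q? : Dec Q) → ⟦ Q? ×-dec ¬? P? ⟧ + ⟦ P? ⟧ ≤ ⟦ Q? ⟧
  ⟦⟧-difference P⇒Q (yes p) (yes _) = ≤-refl
  ⟦⟧-difference P⇒Q (yes p) (no ¬q) = contradiction (P⇒Q p) ¬q
  ⟦⟧-difference P⇒Q (no _)  (yes _) = ≤-refl
  ⟦⟧-difference P⇒Q (no _)  (no _)  = z≤n

  ⟦⟧-× : (P? : Dec P) (Q? : Dec Q) → ⟦ P? ×-dec Q? ⟧ ≡ ⟦ P? ⟧ * ⟦ Q? ⟧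
  ⟦⟧-× (no _)  _       = refl
  ⟦⟧-× (yes _) (no _)  = refl
  ⟦⟧-× (yes _) (yes _) = refl

module _ {p} {P : Set p} where

  ⟦⟧-true : (P? : Dec P) → P → ⟦ P? ⟧ ≡ 1
  ⟦⟧-true (yes _) _ = refl
  ⟦⟧-true (no ¬p) p = contradiction p ¬p

  ⟦⟧-false : (P? : Dec P) → ¬ P → ⟦ P? ⟧ ≡ 0
  ⟦⟧-false (yes p) ¬p = contradiction p ¬p
  ⟦⟧-false (no _)  _  = refl

  ⟦⟧≤1 : (P? : Dec P) → ⟦ P? ⟧ ≤ 1
  ⟦⟧≤1 (yes _) = ≤-refl
  ⟦⟧≤1 (no _)  = z≤n

  ⟦⟧≤ : ∀ {n} (P? : Dec P) → (P → 1 ≤ n) → ⟦ P? ⟧ ≤ n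
  ⟦⟧≤ (yes p) 1≤n = 1≤n p
  ⟦⟧≤ (no _)  _   = z≤n

  ⟦⟧≥1⇒ : (P? : Dec P) → 1 ≤ ⟦ P? ⟧ → P
  ⟦⟧≥1⇒ (yes p) _ = p

-- Sums over subsets and over vertices

∑⊆ : ∀ n → (Subset n → ℕ) → ℕ
∑⊆ zero    g = g []
∑⊆ (suc n) g = ∑⊆ n (g ∘ (outside ∷_)) + ∑⊆ n (g ∘ (inside ∷_))

∑⊆-cong : ∀ {n} {g h : Subset n → ℕ} → (∀ σ → g σ ≡ h σ) → ∑⊆ n g ≡ ∑⊆ n h
∑⊆-cong {zero}  g≗h = g≗h []
∑⊆-cong {suc n} g≗h =
  cong₂ _+_ (∑⊆-cong (g≗h ∘ (outside ∷_))) (∑⊆-cong (g≗h ∘ (inside ∷_)))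

∑⊆-zero : ∀ {n} {g : Subset n → ℕ} → (∀ σ → g σ ≡ 0) → ∑⊆ n g ≡ 0
∑⊆-zero {zero}  g≗0 = g≗0 []
∑⊆-zero {suc n} g≗0 =
  cong₂ _+_ (∑⊆-zero (g≗0 ∘ (outside ∷_))) (∑⊆-zero (g≗0 ∘ (inside ∷_)))

∑⊆-distrib-+ : ∀ {n} (g h : Subset n → ℕ) → ∑⊆ n (λ σ → g σ + h σ) ≡ ∑⊆ n g + ∑⊆ n h
∑⊆-distrib-+ {zero}  g h = refl
∑⊆-distrib-+ {suc n} g h = trans
  (cong₂ _+_ (∑⊆-distrib-+ (g ∘ (outside ∷_)) (h ∘ (outside ∷_)))
             (∑⊆-distrib-+ (g ∘ (inside ∷_)) (h ∘ (inside ∷_))))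
  (interchange (∑⊆ n (g ∘ (outside ∷_))) _ _ _)
  where
  interchange : ∀ a b c d → (a + b) + (c + d) ≡ (a + c) + (b + d)
  interchange = solve-∀

∑⊆-comm : ∀ {m n} (g : Subset m → Subset n → ℕ) →
          ∑⊆ m (λ σ → ∑⊆ n (g σ)) ≡ ∑⊆ n (λ τ → ∑⊆ m (λ σ → g σ τ))
∑⊆-comm {zero}  g = refl
∑⊆-comm {suc m} {n} g = trans
  (cong₂ _+_ (∑⊆-comm (g ∘ (outside ∷_))) (∑⊆-comm (g ∘ (inside ∷_))))
  (sym (∑⊆-distrib-+ {n} _ _))

∑⊆-++ : ∀ m {n} (g : Subset (m + n) → ℕ) →
        ∑⊆ (m + n) g ≡ ∑⊆ m (λ σ → ∑⊆ n (λ τ → g (σ Vec.++ τ)))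
∑⊆-++ zero    g = refl
∑⊆-++ (suc m) g = cong₂ _+_ (∑⊆-++ m (g ∘ (outside ∷_))) (∑⊆-++ m (g ∘ (inside ∷_)))

∑⊆-≥ : ∀ {n} (g : Subset n → ℕ) σ → g σ ≤ ∑⊆ n g
∑⊆-≥ g []            = ≤-refl
∑⊆-≥ g (outside ∷ σ) = ≤-trans (∑⊆-≥ (g ∘ (outside ∷_)) σ) (m≤m+n _ _)
∑⊆-≥ g (inside ∷ σ)  = ≤-trans (∑⊆-≥ (g ∘ (inside ∷_)) σ) (m≤n+m _ _)

∑⊆-positive : ∀ {n} (g : Subset n → ℕ) → 1 ≤ ∑⊆ n g → ∃ λ σ → 1 ≤ g σ
∑⊆-positive {zero}  g pos = [] , pos
∑⊆-positive {suc n} g pos with ∑⊆ n (g ∘ (outside ∷_)) in eq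
... | zero  = let σ , gσ = ∑⊆-positive (g ∘ (inside ∷_)) pos in inside ∷ σ , gσ
... | suc _ = let σ , gσ = ∑⊆-positive (g ∘ (outside ∷_)) (subst (1 ≤_) (sym eq) (s≤s z≤n))
              in outside ∷ σ , gσ

sum-mono : ∀ {n} {a b : Vector ℕ n} → (∀ i → a i ≤ b i) → sum a ≤ sum b
sum-mono {zero}  a≤b = z≤n
sum-mono {suc n} a≤b = +-mono-≤ (a≤b zero) (sum-mono (a≤b ∘ suc))

∑< : ∀ n → (Fin n → Fin n → ℕ) → ℕ
∑< zero    a = 0
∑< (suc n) a = sum (λ j → a zero (suc j)) + ∑< n (λ i j → a (suc i) (suc j))

∑<-mono : ∀ {n} {a b : Fin n → Fin n → ℕ} → (∀ i j → i ≢ j → a i j ≤ b i j) →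
          ∑< n a ≤ ∑< n b
∑<-mono {zero}  a≤b = z≤n
∑<-mono {suc n} a≤b = +-mono-≤ (sum-mono (λ j → a≤b zero (suc j) λ ()))
  (∑<-mono (λ i j i≢j → a≤b (suc i) (suc j) (i≢j ∘ Fin.suc-injective)))

∑<-+-flip≤ : ∀ {n} (a : Fin n → Fin n → ℕ) →
             ∑< n (λ i j → a i j + a j i) ≤ sum (λ i → sum (a i))
∑<-+-flip≤ {zero}  a = z≤n
∑<-+-flip≤ {suc n} a = begin
  sum (λ j → a zero (suc j) + a (suc j) zero) + ∑< n (λ i j → a (suc i) (suc j) + a (suc j) (suc i))
    ≤⟨ +-monoʳ-≤ (sum (λ j → a zero (suc j) + a (suc j) zero)) (∑<-+-flip≤ (λ i j → a (suc i) (suc j))) ⟩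
  sum (λ j → a zero (suc j) + a (suc j) zero) + rest
    ≡⟨ cong (_+ rest) (∑-distrib-+ (λ j → a zero (suc j)) (λ j → a (suc j) zero)) ⟩
  (row + column) + rest
    ≡⟨ +-assoc row column rest ⟩
  row + (column + rest)
    ≡⟨ cong (λ s → row + s) (∑-distrib-+ (λ i → a (suc i) zero) (λ i → sum (λ j → a (suc i) (suc j)))) ⟨
  row + sum (λ i → sum (a (suc i)))
    ≤⟨ +-monoˡ-≤ _ (m≤n+m row (a zero zero)) ⟩
  sum (a zero) + sum (λ i → sum (a (suc i))) ∎
  where
  row    = sum (λ j → a zero (suc j))
  column = sum (λ i → a (suc i) zero)
  rest   = sum (λ i → sum (λ j → a (suc i) (suc j)))

∑⊆-∅ : ∀ {n} (g : Subset n → ℕ) → (∀ σ → 1 ≤ ∣ σ ∣ → g σ ≡ 0) → ∑⊆ n g ≡ g ∅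
∑⊆-∅ {zero}  g g≗0 = refl
∑⊆-∅ {suc n} g g≗0 = trans
  (cong₂ _+_ (∑⊆-∅ (g ∘ (outside ∷_)) (g≗0 ∘ (outside ∷_)))
             (∑⊆-zero (λ σ → g≗0 (inside ∷ σ) (s≤s z≤n))))
  (+-identityʳ _)

∑⊆-vertices : ∀ {n} (p : Subset n → ℕ) (w : ℕ → ℕ) → (∀ σ → 2 ≤ ∣ σ ∣ → p σ ≡ 0) →
              ∑⊆ n (λ σ → p σ * w ∣ σ ∣) ≡ p ∅ * w 0 + sum (λ i → p ⁅ i ⁆) * w 1
∑⊆-vertices {zero}  p w p≗0 = sym (+-identityʳ _)
∑⊆-vertices {suc n} p w p≗0 = begin-equality
  ∑⊆ n (λ σ → p (outside ∷ σ) * w ∣ σ ∣) + ∑⊆ n (λ σ → p (inside ∷ σ) * w (suc ∣ σ ∣))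
    ≡⟨ cong₂ _+_
         (∑⊆-vertices (p ∘ (outside ∷_)) w (p≗0 ∘ (outside ∷_)))
         (∑⊆-∅ (λ σ → p (inside ∷ σ) * w (suc ∣ σ ∣))
           (λ σ 1≤ → cong (_* w (suc ∣ σ ∣)) (p≗0 (inside ∷ σ) (s≤s 1≤)))) ⟩
  (p∅ * w 0 + rest * w 1) + p₀ * w (suc ∣ ∅ {n} ∣)
    ≡⟨ cong (λ s → (p∅ * w 0 + rest * w 1) + p₀ * w (suc s)) (∣⊥∣≡0 n) ⟩
  (p∅ * w 0 + rest * w 1) + p₀ * w 1
    ≡⟨ regroup p∅ rest p₀ (w 0) (w 1) ⟩
  p∅ * w 0 + (p₀ + rest) * w 1 ∎
  where
  p∅   = p (outside ∷ ∅)
  p₀   = p (inside ∷ ∅)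
  rest = sum (λ i → p (outside ∷ ⁅ i ⁆))
  regroup : ∀ a b c x y → (a * x + b * y) + c * y ≡ a * x + (c + b) * y
  regroup = solve-∀

∑⊆-edges : ∀ {n} (p : Subset n → ℕ) (w : ℕ → ℕ) → (∀ σ → 3 ≤ ∣ σ ∣ → p σ ≡ 0) →
           ∑⊆ n (λ σ → p σ * w ∣ σ ∣) ≡
           p ∅ * w 0 + sum (λ i → p ⁅ i ⁆) * w 1 + ∑< n (λ i j → p (⁅ i ⁆ ∪ ⁅ j ⁆)) * w 2
∑⊆-edges {zero}  p w p≗0 = sym (trans (+-identityʳ _) (+-identityʳ _))
∑⊆-edges {suc n} p w p≗0 = begin-equality
  ∑⊆ n (λ σ → p (outside ∷ σ) * w ∣ σ ∣) + ∑⊆ n (λ σ → p (inside ∷ σ) * w (suc ∣ σ ∣))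
    ≡⟨ cong₂ _+_
         (∑⊆-edges (p ∘ (outside ∷_)) w (p≗0 ∘ (outside ∷_)))
         (∑⊆-vertices (p ∘ (inside ∷_)) (w ∘ suc) (λ σ 2≤ → p≗0 (inside ∷ σ) (s≤s 2≤))) ⟩
  (p∅ * w 0 + vertices * w 1 + edges * w 2) + (p₀ * w 1 + sum (λ j → p (inside ∷ ⁅ j ⁆)) * w 2)
    ≡⟨ cong (λ s → (p∅ * w 0 + vertices * w 1 + edges * w 2) + (p₀ * w 1 + s * w 2))
         (sum-cong-≗ (λ j → cong (p ∘ (inside ∷_)) (∪-identityˡ ⁅ j ⁆))) ⟨
  (p∅ * w 0 + vertices * w 1 + edges * w 2) + (p₀ * w 1 + edges₀ * w 2)
    ≡⟨ regroup p∅ vertices p₀ edges edges₀ (w 0) (w 1) (w 2) ⟩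
  p∅ * w 0 + (p₀ + vertices) * w 1 + (edges₀ + edges) * w 2 ∎
  where
  p∅       = p (outside ∷ ∅)
  p₀       = p (inside ∷ ∅)
  vertices = sum (λ i → p (outside ∷ ⁅ i ⁆))
  edges₀   = sum (λ j → p (inside ∷ (∅ ∪ ⁅ j ⁆)))
  edges    = ∑< n (λ i j → p (outside ∷ (⁅ i ⁆ ∪ ⁅ j ⁆)))
  regroup : ∀ a b c d e x y z → (a * x + b * y + d * z) + (c * y + e * z) ≡
                                a * x + (c + b) * y + (e + d) * z
  regroup = solve-∀

-- Initial segments of the bipartite graphs with colour classes of almost equal size

count : ∀ {p} {P : ℕ → Set p} → (∀ i → Dec (P i)) → ℕ → ℕ
count P? zero    = 0
count P? (suc i) = count P? i + ⟦ P? i ⟧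

count-rank : ∀ {p} {P : ℕ → Set p} (P? : ∀ i → Dec (P i)) t j →
             count (λ i → P? i ×-dec (count P? i <? t)) j ≡ t ⊓ count P? j
count-rank P? t zero    = sym (⊓-zeroʳ t)
count-rank P? t (suc j) = begin-equality
  count Q? j + ⟦ P? j ×-dec (c <? t) ⟧  ≡⟨ cong₂ _+_ (count-rank P? t j) (⟦⟧-× (P? j) (c <? t)) ⟩
  t ⊓ c + ⟦ P? j ⟧ * ⟦ c <? t ⟧         ≡⟨ step (P? j) (c <? t) ⟩
  t ⊓ (c + ⟦ P? j ⟧)                    ∎
  where
  c = count P? j
  Q? = λ i → P? i ×-dec (count P? i <? t)
  step : ∀ {p} {P : Set p} (A? : Dec P) (B? : Dec (c < t)) →
         t ⊓ c + ⟦ A? ⟧ * ⟦ B? ⟧ ≡ t ⊓ (c + ⟦ A? ⟧)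
  step (no _)  _         = trans (+-identityʳ _) (cong (t ⊓_) (sym (+-identityʳ c)))
  step (yes _) (yes c<t) = begin-equality
    t ⊓ c + 1    ≡⟨ cong (_+ 1) (m≥n⇒m⊓n≡n (<⇒≤ c<t)) ⟩
    c + 1        ≡⟨ m≥n⇒m⊓n≡n (subst (_≤ t) (+-comm 1 c) c<t) ⟨
    t ⊓ (c + 1)  ∎
  step (yes _) (no c≮t) = begin-equality
    t ⊓ c + 0    ≡⟨ +-identityʳ _ ⟩
    t ⊓ c        ≡⟨ m≤n⇒m⊓n≡m (≮⇒≥ c≮t) ⟩
    t            ≡⟨ m≤n⇒m⊓n≡m (≤-trans (≮⇒≥ c≮t) (m≤m+n c 1)) ⟨
    t ⊓ (c + 1)  ∎

parity : ℕ → Fin 2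
parity zero    = zero
parity (suc n) = opposite (parity n)

Opposite : ℕ → ℕ → Set
Opposite j i = parity i ≢ parity j

opposite? : ∀ j i → Dec (Opposite j i)
opposite? j i = ¬? (parity i Fin.≟ parity j)

neighboursBelow : ℕ → ℕ
neighboursBelow j = count (opposite? j) j

edgesBelow : ℕ → ℕ
edgesBelow zero    = 0
edgesBelow (suc j) = edgesBelow j + neighboursBelow j

count-opposite : ∀ j i → count (opposite? j) i + count (opposite? (suc j)) i ≡ i
count-opposite j zero    = refl
count-opposite j (suc i) = begin-equality
  (a + ⟦ opposite? j i ⟧) + (b + ⟦ opposite? (suc j) i ⟧)
    ≡⟨ interchange a _ b _ ⟩
  (⟦ opposite? j i ⟧ + ⟦ opposite? (suc j) i ⟧) + (a + b)
    ≡⟨ cong₂ _+_ (one-differs (parity i) (parity j)) (count-opposite j i) ⟩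
  suc i ∎
  where
  a = count (opposite? j) i
  b = count (opposite? (suc j)) i
  interchange : ∀ a b c d → (a + b) + (c + d) ≡ (b + d) + (a + c)
  interchange = solve-∀
  one-differs : ∀ (x y : Fin 2) → ⟦ ¬? (x Fin.≟ y) ⟧ + ⟦ ¬? (x Fin.≟ opposite y) ⟧ ≡ 1
  one-differs zero       zero       = refl
  one-differs zero       (suc zero) = refl
  one-differs (suc zero) zero       = refl
  one-differs (suc zero) (suc zero) = refl

neighboursBelow-+ : ∀ j → neighboursBelow j + neighboursBelow (suc j) ≡ suc j
neighboursBelow-+ j = begin-equality
  a + (b + ⟦ opposite? (suc j) j ⟧)  ≡⟨ cong (λ s → a + (b + s)) (⟦⟧-true (opposite? (suc j) j) (≢opposite (parity j))) ⟩
  a + (b + 1)                        ≡⟨ +-assoc a b 1 ⟨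
  a + b + 1                          ≡⟨ cong (_+ 1) (count-opposite j j) ⟩
  j + 1                              ≡⟨ +-comm j 1 ⟩
  suc j                              ∎
  where
  a = neighboursBelow j
  b = count (opposite? (suc j)) j
  ≢opposite : ∀ (x : Fin 2) → x ≢ opposite x
  ≢opposite zero       ()
  ≢opposite (suc zero) ()

edgesBelow-mono : ∀ {m n} → m ≤ n → edgesBelow m ≤ edgesBelow n
edgesBelow-mono {n = zero}  z≤n = z≤n
edgesBelow-mono {m} {suc n} m≤1+n with m≤n⇒m<n∨m≡n m≤1+n
... | inj₁ (s≤s m≤n) = ≤-trans (edgesBelow-mono m≤n) (m≤m+n _ _)
... | inj₂ refl      = ≤-refl

*≤edgesBelow : ∀ a b → a * b ≤ edgesBelow (a + b)
*≤edgesBelow zero    b       = z≤n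
*≤edgesBelow (suc a) zero    = ≤-trans (≤-reflexive (*-zeroʳ a)) z≤n
*≤edgesBelow (suc a) (suc b) = begin
  suc a * suc b                                                   ≡⟨ expand a b ⟩
  a * b + suc (a + b)                                             ≤⟨ +-monoˡ-≤ _ (*≤edgesBelow a b) ⟩
  edgesBelow s + suc s                                            ≡⟨ cong (λ t → edgesBelow s + t) (neighboursBelow-+ s) ⟨
  edgesBelow s + (neighboursBelow s + neighboursBelow (suc s))    ≡⟨ +-assoc (edgesBelow s) _ _ ⟨
  edgesBelow (2 + s)                                              ≡⟨ cong (edgesBelow ∘ suc) (+-suc a b) ⟨
  edgesBelow (suc a + suc b)                                      ∎
  where
  s = a + b
  expand : ∀ a b → suc a * suc b ≡ a * b + suc (a + b)
  expand = solve-∀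

⊓-+ : ∀ t a b → t ⊓ a + (t ∸ a) ⊓ b ≡ t ⊓ (a + b)
⊓-+ t       zero    b = cong (_+ t ⊓ b) (⊓-zeroʳ t)
⊓-+ zero    (suc a) b = refl
⊓-+ (suc t) (suc a) b = cong suc (⊓-+ t a b)

-- The position in a subset of Fin (suc n) that is listed first is the vertex
-- with number n; the edges are listed by increasing larger endpoint.
module _ (N E : ℕ) where

  -- Edge {i < j} comes after edgesBelow j + count (opposite? j) i others.
  Edge : ℕ → ℕ → Set
  Edge j i = Opposite j i × count (opposite? j) i < E ∸ edgesBelow j

  edge? : ∀ j i → Dec (Edge j i)
  edge? j i = opposite? j i ×-dec (count (opposite? j) i <? E ∸ edgesBelow j)

  InLink : ∀ {n} → ℕ → Subset n → Set
  InLink         j []            = ⊤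
  InLink         j (outside ∷ σ) = InLink j σ
  InLink {suc i} j (inside ∷ σ)  = Edge j i × ∣ σ ∣ ≡ 0

  InSegment : ∀ {n} → Subset n → Set
  InSegment         []            = ⊤
  InSegment         (outside ∷ σ) = InSegment σ
  InSegment {suc j} (inside ∷ σ)  = j < N × InLink j σ

  inLink? : ∀ {n} j (σ : Subset n) → Dec (InLink j σ)
  inLink?         j []            = yes tt
  inLink?         j (outside ∷ σ) = inLink? j σ
  inLink? {suc i} j (inside ∷ σ)  = edge? j i ×-dec (∣ σ ∣ ≟ 0)

  inSegment? : ∀ {n} (σ : Subset n) → Dec (InSegment σ)
  inSegment?         []            = yes tt
  inSegment?         (outside ∷ σ) = inSegment? σ
  inSegment? {suc j} (inside ∷ σ)  = (j <? N) ×-dec inLink? j σ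

  empty-inLink : ∀ {n} j (σ : Subset n) → ∣ σ ∣ ≡ 0 → InLink j σ
  empty-inLink j []            _ = tt
  empty-inLink j (outside ∷ σ) e = empty-inLink j σ e

  inLink-closed : ∀ {n} j {σ τ : Subset n} → τ ⊆ σ → InLink j σ → InLink j τ
  inLink-closed j {[]}          {[]}          _   _       = tt
  inLink-closed j {outside ∷ σ} {outside ∷ τ} τ⊆σ l       = inLink-closed j (drop-∷-⊆ τ⊆σ) l
  inLink-closed j {outside ∷ σ} {inside ∷ τ}  τ⊆σ l       = case τ⊆σ here of λ ()
  inLink-closed j {inside ∷ σ}  {outside ∷ τ} τ⊆σ (_ , e) =
    empty-inLink j τ (n≤0⇒n≡0 (subst (∣ τ ∣ ≤_) e (p⊆q⇒∣p∣≤∣q∣ (drop-∷-⊆ τ⊆σ))))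
  inLink-closed j {inside ∷ σ}  {inside ∷ τ}  τ⊆σ (a , e) =
    a , n≤0⇒n≡0 (subst (∣ τ ∣ ≤_) e (p⊆q⇒∣p∣≤∣q∣ (drop-∷-⊆ τ⊆σ)))

  inLink⇒inSegment : ∀ {n j} (σ : Subset n) → n ≤ N → InLink j σ → InSegment σ
  inLink⇒inSegment []            _   _       = tt
  inLink⇒inSegment (outside ∷ σ) n<N l       = inLink⇒inSegment σ (<⇒≤ n<N) l
  inLink⇒inSegment (inside ∷ σ)  n<N (_ , e) = n<N , empty-inLink _ σ e

  inSegment-closed : ∀ {n} {σ τ : Subset n} → τ ⊆ σ → InSegment σ → InSegment τ
  inSegment-closed {σ = []}          {[]}          _   _         = tt
  inSegment-closed {σ = outside ∷ σ} {outside ∷ τ} τ⊆σ s         = inSegment-closed (drop-∷-⊆ τ⊆σ) s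
  inSegment-closed {σ = outside ∷ σ} {inside ∷ τ}  τ⊆σ s         = case τ⊆σ here of λ ()
  inSegment-closed {σ = inside ∷ σ}  {outside ∷ τ} τ⊆σ (j<N , l) =
    inLink⇒inSegment τ (<⇒≤ j<N) (inLink-closed _ (drop-∷-⊆ τ⊆σ) l)
  inSegment-closed {σ = inside ∷ σ}  {inside ∷ τ}  τ⊆σ (j<N , l) =
    j<N , inLink-closed _ (drop-∷-⊆ τ⊆σ) l

  ∑⊆-inLink : ∀ n j (w : ℕ → ℕ) →
              ∑⊆ n (λ σ → ⟦ inLink? j σ ⟧ * w ∣ σ ∣) ≡ w 0 + count (edge? j) n * w 1
  ∑⊆-inLink zero    j w = refl
  ∑⊆-inLink (suc i) j w = begin-equality
    ∑⊆ i (λ σ → ⟦ inLink? j σ ⟧ * w ∣ σ ∣) + ∑⊆ i (λ σ → ⟦ edge? j i ×-dec (∣ σ ∣ ≟ 0) ⟧ * w (suc ∣ σ ∣))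
      ≡⟨ cong₂ _+_ (∑⊆-inLink i j w)
           (∑⊆-∅ {i} _ (λ σ 1≤ → cong (_* w (suc ∣ σ ∣)) (⟦⟧-false (edge? j i ×-dec (∣ σ ∣ ≟ 0))
             (λ (_ , e) → case subst (1 ≤_) e 1≤ of λ ())))) ⟩
    (w 0 + c * w 1) + ⟦ edge? j i ×-dec (∣ ∅ {i} ∣ ≟ 0) ⟧ * w (suc ∣ ∅ {i} ∣)
      ≡⟨ cong (λ s → (w 0 + c * w 1) + ⟦ edge? j i ×-dec (s ≟ 0) ⟧ * w (suc s)) (∣⊥∣≡0 i) ⟩
    (w 0 + c * w 1) + ⟦ edge? j i ×-dec (0 ≟ 0) ⟧ * w 1
      ≡⟨ cong (λ s → (w 0 + c * w 1) + s * w 1)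
           (trans (⟦⟧-× (edge? j i) (0 ≟ 0)) (*-identityʳ ⟦ edge? j i ⟧)) ⟩
    (w 0 + c * w 1) + ⟦ edge? j i ⟧ * w 1
      ≡⟨ regroup (w 0) c ⟦ edge? j i ⟧ (w 1) ⟩
    w 0 + (c + ⟦ edge? j i ⟧) * w 1 ∎
    where
    c = count (edge? j) i
    regroup : ∀ a b c d → (a + b * d) + c * d ≡ a + (b + c) * d
    regroup = solve-∀

  ∑⊆-inSegment : ∀ n (w : ℕ → ℕ) →
                 ∑⊆ n (λ σ → ⟦ inSegment? σ ⟧ * w ∣ σ ∣) ≡
                 w 0 + n ⊓ N * w 1 + E ⊓ edgesBelow (n ⊓ N) * w 2
  ∑⊆-inSegment zero    w = sym (trans (cong (λ s → w 0 + 0 + s * w 2) (⊓-zeroʳ E)) (+-identityʳ _))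
  ∑⊆-inSegment (suc j) w = trans
    (cong₂ _+_ (∑⊆-inSegment j w) (∑⊆-cong {j} (λ σ →
      trans (cong (_* w (suc ∣ σ ∣)) (⟦⟧-× (j <? N) (inLink? j σ)))
            (*-assoc ⟦ j <? N ⟧ ⟦ inLink? j σ ⟧ (w (suc ∣ σ ∣))))))
    (step (j <? N))
    where
    step : (j<?N : Dec (j < N)) →
      (w 0 + j ⊓ N * w 1 + E ⊓ edgesBelow (j ⊓ N) * w 2) +
        ∑⊆ j (λ σ → ⟦ j<?N ⟧ * (⟦ inLink? j σ ⟧ * w (suc ∣ σ ∣))) ≡
      w 0 + suc j ⊓ N * w 1 + E ⊓ edgesBelow (suc j ⊓ N) * w 2
    step (no j≮N) = begin-equality
      before + ∑⊆ j (λ σ → 0)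
        ≡⟨ cong (λ s → before + s) (∑⊆-zero {j} (λ _ → refl)) ⟩
      before + 0
        ≡⟨ +-identityʳ _ ⟩
      before
        ≡⟨ cong (λ s → w 0 + s * w 1 + E ⊓ edgesBelow s * w 2)
             (trans (m≥n⇒m⊓n≡n (≮⇒≥ j≮N)) (sym (m≥n⇒m⊓n≡n (m≤n⇒m≤1+n (≮⇒≥ j≮N))))) ⟩
      w 0 + suc j ⊓ N * w 1 + E ⊓ edgesBelow (suc j ⊓ N) * w 2 ∎
      where
      before = w 0 + j ⊓ N * w 1 + E ⊓ edgesBelow (j ⊓ N) * w 2
    step (yes j<N) rewrite m≤n⇒m⊓n≡m (<⇒≤ j<N) | m≤n⇒m⊓n≡m j<N = begin-equality
      (w 0 + j * w 1 + E ⊓ edgesBelow j * w 2) + ∑⊆ j (λ σ → 1 * (⟦ inLink? j σ ⟧ * w (suc ∣ σ ∣)))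
        ≡⟨ cong (λ s → (w 0 + j * w 1 + E ⊓ edgesBelow j * w 2) + s)
             (trans (∑⊆-cong {j} (λ σ → *-identityˡ _)) (∑⊆-inLink j j (w ∘ suc))) ⟩
      (w 0 + j * w 1 + E ⊓ edgesBelow j * w 2) + (w 1 + count (edge? j) j * w 2)
        ≡⟨ cong (λ s → (w 0 + j * w 1 + E ⊓ edgesBelow j * w 2) + (w 1 + s * w 2))
             (count-rank (opposite? j) (E ∸ edgesBelow j) j) ⟩
      (w 0 + j * w 1 + E ⊓ edgesBelow j * w 2) + (w 1 + (E ∸ edgesBelow j) ⊓ neighboursBelow j * w 2)
        ≡⟨ regroup′ (w 0) j (E ⊓ edgesBelow j) _ (w 1) (w 2) ⟩
      w 0 + suc j * w 1 + (E ⊓ edgesBelow j + (E ∸ edgesBelow j) ⊓ neighboursBelow j) * w 2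
        ≡⟨ cong (λ s → w 0 + suc j * w 1 + s * w 2) (⊓-+ E (edgesBelow j) (neighboursBelow j)) ⟩
      w 0 + suc j * w 1 + E ⊓ edgesBelow (suc j) * w 2 ∎
      where
      regroup′ : ∀ a b c d y z → (a + b * y + c * z) + (y + d * z) ≡ a + suc b * y + (c + d) * z
      regroup′ = solve-∀

x∈p⇒1≤∣p∣ : ∀ {n} {x : Fin n} {p} → x ∈ p → 1 ≤ ∣ p ∣
x∈p⇒1≤∣p∣ x∈p = ≤-<-trans z≤n (x∈p⇒∣p-x∣<∣p∣ x∈p)

two-elements : ∀ {n} {x y : Fin n} {p} → x ∈ p → y ∈ p → x ≢ y → 2 ≤ ∣ p ∣
two-elements x∈p y∈p x≢y =
  ≤-<-trans (x∈p⇒1≤∣p∣ (x∈p∧x≢y⇒x∈p-y x∈p x≢y)) (x∈p⇒∣p-x∣<∣p∣ y∈p)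

three-elements : ∀ {n} {x y z : Fin n} {p} → x ∈ p → y ∈ p → z ∈ p →
                 x ≢ y → x ≢ z → y ≢ z → 3 ≤ ∣ p ∣
three-elements x∈p y∈p z∈p x≢y x≢z y≢z =
  ≤-<-trans (two-elements (x∈p∧x≢y⇒x∈p-y x∈p x≢z) (x∈p∧x≢y⇒x∈p-y y∈p y≢z) x≢y)
            (x∈p⇒∣p-x∣<∣p∣ z∈p)

vertexParity : ∀ {n} → Fin n → Fin 2
vertexParity {suc j} zero    = parity j
vertexParity {suc j} (suc v) = vertexParity v

module _ {N E : ℕ} where

  inLink-parity : ∀ {n j} (σ : Subset n) → InLink N E j σ →
                  ∀ {v} → v ∈ σ → vertexParity v ≢ parity j
  inLink-parity (outside ∷ σ) l             (there v∈σ) = inLink-parity σ l v∈σ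
  inLink-parity (inside ∷ σ)  ((o , _) , _) here        = o
  inLink-parity (inside ∷ σ)  (_ , e)       (there v∈σ) =
    case subst (1 ≤_) e (x∈p⇒1≤∣p∣ v∈σ) of λ ()

  inSegment-parity : ∀ {n} (σ : Subset n) → InSegment N E σ →
                     ∀ u v → u ∈ σ → v ∈ σ → u ≢ v → vertexParity u ≢ vertexParity v
  inSegment-parity (outside ∷ σ) s (suc u) (suc v) (there u∈σ) (there v∈σ) u≢v =
    inSegment-parity σ s u v u∈σ v∈σ (u≢v ∘ cong suc)
  inSegment-parity (inside ∷ σ) (_ , l) zero zero here here u≢v = contradiction refl u≢v
  inSegment-parity (inside ∷ σ) (_ , l) zero (suc v) here (there v∈σ) u≢v =
    inLink-parity σ l v∈σ ∘ sym
  inSegment-parity (inside ∷ σ) (_ , l) (suc u) zero (there u∈σ) here u≢v =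
    inLink-parity σ l u∈σ
  inSegment-parity (inside ∷ σ) (j<N , l) (suc u) (suc v) (there u∈σ) (there v∈σ) u≢v =
    inSegment-parity σ (inLink⇒inSegment N E σ (<⇒≤ j<N) l) u v u∈σ v∈σ (u≢v ∘ cong suc)

module _ {N N′ E E′} (N≤N′ : N ≤ N′) (E≤E′ : E ≤ E′) where

  inLink-mono : ∀ {n j} (σ : Subset n) → InLink N E j σ → InLink N′ E′ j σ
  inLink-mono     []            _             = tt
  inLink-mono     (outside ∷ σ) l             = inLink-mono σ l
  inLink-mono {j = j} (inside ∷ σ)  ((o , r) , e) =
    (o , <-≤-trans r (∸-monoˡ-≤ (edgesBelow j) E≤E′)) , e

  inSegment-mono : ∀ {n} (σ : Subset n) → InSegment N E σ → InSegment N′ E′ σ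
  inSegment-mono []            _         = tt
  inSegment-mono (outside ∷ σ) s         = inSegment-mono σ s
  inSegment-mono (inside ∷ σ)  (j<N , l) = <-≤-trans j<N N≤N′ , inLink-mono σ l

-- Mantel's theorem

enumerate : ∀ {n} → Complex n → (ℕ → ℕ) → ℕ
enumerate {n} Δ w = ∑⊆ n (λ σ → ⟦ face? Δ σ ⟧ * w ∣ σ ∣)

numVertices : ∀ {n} → Complex n → ℕ
numVertices G = sum (λ i → ⟦ face? G ⁅ i ⁆ ⟧)

numEdges : ∀ {n} → Complex n → ℕ
numEdges {n} G = ∑< n (λ i j → ⟦ face? G (⁅ i ⁆ ∪ ⁅ j ⁆) ⟧)

enumerate-graph : ∀ {n} (G : Complex n) → (∀ σ → Face G σ → ∣ σ ∣ ≤ 2) → ∀ w →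
  enumerate G w ≡ ⟦ face? G ∅ ⟧ * w 0 + numVertices G * w 1 + numEdges G * w 2
enumerate-graph G small w = ∑⊆-edges (λ σ → ⟦ face? G σ ⟧) w
  (λ σ 3≤∣σ∣ → ⟦⟧-false (face? G σ) (λ σ∈G → <⇒≱ 3≤∣σ∣ (small σ σ∈G)))

numVertices≤ : ∀ {n} (G : Complex n) → numVertices G ≤ n
numVertices≤ G = bound (λ i → ⟦⟧≤1 (face? G ⁅ i ⁆))
  where
  bound : ∀ {n} {a : Vector ℕ n} → (∀ i → a i ≤ 1) → sum a ≤ n
  bound {zero}  a≤1 = z≤n
  bound {suc n} a≤1 = +-mono-≤ (a≤1 zero) (bound (a≤1 ∘ suc))

adjacent? : ∀ {n} (G : Complex n) u v → Dec (Adjacent G u v)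
adjacent? G u v = ¬? (u Fin.≟ v) ×-dec face? G (⁅ u ⁆ ∪ ⁅ v ⁆)

adjacent-sym : ∀ {n} (G : Complex n) {u v} → Adjacent G u v → Adjacent G v u
adjacent-sym G {u} {v} (u≢v , uv) = u≢v ∘ sym , subst (Face G) (∪-comm ⁅ u ⁆ ⁅ v ⁆) uv

adjacent⇒vertex : ∀ {n} (G : Complex n) {u v} → Adjacent G u v → Face G ⁅ v ⁆
adjacent⇒vertex G {u} {v} (_ , uv) = closed G (q⊆p∪q ⁅ u ⁆ ⁅ v ⁆) uv

TriangleFree : ∀ {n} → Complex n → Set
TriangleFree G = ∀ x y z → Adjacent G x y → Adjacent G x z → ¬ Adjacent G y z

maximum : ∀ {n} (g : Vector ℕ (suc n)) → ∃ λ x → ∀ y → g y ≤ g x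
maximum {zero}  g = zero , λ { zero → ≤-refl }
maximum {suc n} g with maximum (g ∘ suc)
... | x , max with ≤-total (g zero) (g (suc x))
...   | inj₁ g₀≤ = suc x , λ { zero → g₀≤ ; (suc y) → max y }
...   | inj₂ ≤g₀ = zero , λ { zero → ≤-refl ; (suc y) → ≤-trans (max y) ≤g₀ }

-- If x has maximal degree D, then its neighbours are independent, so every edge has
-- an endpoint among the U other vertices; each of these is on at most D edges.
mantel : ∀ {n} (G : Complex n) → TriangleFree G → numEdges G ≤ edgesBelow (numVertices G)
mantel {zero}  G tf = z≤n
mantel {suc n} G tf = begin
  numEdges G
    ≤⟨ ∑<-mono covered ⟩
  ∑< (suc n) (λ i j → u i * a i j + u j * a j i)
    ≤⟨ ∑<-+-flip≤ (λ i j → u i * a i j) ⟩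
  sum (λ i → sum (λ j → u i * a i j))
    ≡⟨ sum-cong-≗ (λ i → *-distribˡ-sum (u i) (a i)) ⟨
  sum (λ i → u i * degree i)
    ≤⟨ sum-mono (λ i → *-monoʳ-≤ (u i) (degree≤D i)) ⟩
  sum (λ i → u i * D)
    ≡⟨ *-distribʳ-sum D u ⟨
  sum u * D
    ≤⟨ *≤edgesBelow (sum u) D ⟩
  edgesBelow (sum u + D)
    ≡⟨ cong edgesBelow (∑-distrib-+ u (a x)) ⟨
  edgesBelow (sum (λ i → u i + a x i))
    ≤⟨ edgesBelow-mono (sum-mono disjoint) ⟩
  edgesBelow (numVertices G) ∎
  where
  a : Fin (suc n) → Fin (suc n) → ℕ
  a i j = ⟦ adjacent? G i j ⟧

  degree : Fin (suc n) → ℕ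
  degree i = sum (a i)

  x = proj₁ (maximum degree)
  D = degree x

  degree≤D : ∀ i → degree i ≤ D
  degree≤D = proj₂ (maximum degree)

  u : Fin (suc n) → ℕ
  u i = ⟦ face? G ⁅ i ⁆ ×-dec ¬? (adjacent? G x i) ⟧

  covers : ∀ {i j} → ¬ Adjacent G x i → Adjacent G i j → u i * a i j ≡ 1
  covers {i} {j} ¬xi ij = cong₂ _*_
    (⟦⟧-true (face? G ⁅ i ⁆ ×-dec ¬? (adjacent? G x i))
             (adjacent⇒vertex G (adjacent-sym G ij) , ¬xi))
    (⟦⟧-true (adjacent? G i j) ij)

  covered : ∀ i j → i ≢ j → ⟦ face? G (⁅ i ⁆ ∪ ⁅ j ⁆) ⟧ ≤ u i * a i j + u j * a j i
  covered i j i≢j = ⟦⟧≤ (face? G (⁅ i ⁆ ∪ ⁅ j ⁆)) λ ij → case adjacent? G x i of λ where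
    (no ¬xi) → ≤-trans (≤-reflexive (sym (covers ¬xi (i≢j , ij)))) (m≤m+n _ _)
    (yes xi) → ≤-trans
      (≤-reflexive (sym (covers (λ xj → tf x i j xi xj (i≢j , ij)) (adjacent-sym G (i≢j , ij)))))
      (m≤n+m _ (u i * a i j))

  disjoint : ∀ i → u i + a x i ≤ ⟦ face? G ⁅ i ⁆ ⟧
  disjoint i = ⟦⟧-difference (adjacent⇒vertex G) (adjacent? G x i) (face? G ⁅ i ⁆)

-- Compressions

-- A way to replace, monotonically in Δ, each subcomplex Δ of Γ by an r-colourable
-- complex with as many faces of each size.
record Compression {n} (Γ : Complex n) (r : ℕ) : Set₁ where
  field
    size     : ℕ
    colour   : Fin size → Fin r
    compress : Complex n → Complex size
    mono     : ∀ {Δ Δ′} → Δ ⊑ Δ′ → compress Δ ⊑ compress Δ′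
    nonvoid  : ∀ {Δ σ} → Face (compress Δ) σ → Face Δ ∅
    proper   : ∀ {Δ} → Δ ⊑ Γ → ProperColoring r (compress Δ) colour
    faces    : ∀ {Δ} → Δ ⊑ Γ → ∀ w → enumerate (compress Δ) w ≡ enumerate Δ w

compress-points : ∀ {n} {Γ : Complex n} → (∀ σ → Face Γ σ → ∣ σ ∣ ≤ 1) → Compression Γ 1
compress-points small = record
  { colour   = λ _ → zero
  ; compress = id
  ; mono     = id
  ; nonvoid  = λ {Δ} → closed Δ ⊥⊆
  ; proper   = λ Δ⊑Γ σ σ∈Δ u v u∈σ v∈σ u≢v _ →
      <⇒≱ (two-elements u∈σ v∈σ u≢v) (small σ (Δ⊑Γ σ σ∈Δ))
  ; faces    = λ _ _ → refl
  }

compressGraph : ∀ {n} → Complex n → Complex n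
compressGraph G = record
  { Face   = λ σ → Face G ∅ × InSegment (numVertices G) (numEdges G) σ
  ; face?  = λ σ → face? G ∅ ×-dec inSegment? (numVertices G) (numEdges G) σ
  ; closed = λ τ⊆σ → λ (∅∈G , s) → ∅∈G , inSegment-closed _ _ τ⊆σ s
  }

compressGraph-mono : ∀ {n} {G H : Complex n} → G ⊑ H → compressGraph G ⊑ compressGraph H
compressGraph-mono {G = G} {H} G⊑H σ (∅∈G , s) = G⊑H ∅ ∅∈G , inSegment-mono
  (sum-mono (λ i → ⟦⟧-mono (G⊑H ⁅ i ⁆) (face? G ⁅ i ⁆) (face? H ⁅ i ⁆)))
  (∑<-mono (λ i j _ → ⟦⟧-mono (G⊑H (⁅ i ⁆ ∪ ⁅ j ⁆)) (face? G (⁅ i ⁆ ∪ ⁅ j ⁆)) (face? H (⁅ i ⁆ ∪ ⁅ j ⁆))))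
  σ s

enumerate-compressGraph : ∀ {n} (G : Complex n) → (∀ σ → Face G σ → ∣ σ ∣ ≤ 2) →
  TriangleFree G → ∀ w → enumerate (compressGraph G) w ≡ enumerate G w
enumerate-compressGraph {n} G small tf w with face? G ∅ in eq
... | no ∅∉G = trans (∑⊆-zero {n} (λ _ → refl))
  (sym (∑⊆-zero (λ σ → cong (_* w ∣ σ ∣) (⟦⟧-false (face? G σ) (∅∉G ∘ closed G ⊥⊆)))))
... | yes _ = begin-equality
  ∑⊆ n (λ σ → ⟦ inSegment? N E σ ⟧ * w ∣ σ ∣)
    ≡⟨ ∑⊆-inSegment N E n w ⟩
  w 0 + n ⊓ N * w 1 + E ⊓ edgesBelow (n ⊓ N) * w 2
    ≡⟨ cong (λ s → w 0 + s * w 1 + E ⊓ edgesBelow s * w 2) (m≥n⇒m⊓n≡n (numVertices≤ G)) ⟩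
  w 0 + N * w 1 + E ⊓ edgesBelow N * w 2
    ≡⟨ cong₂ (λ s t → s + N * w 1 + t * w 2) (sym (+-identityʳ (w 0))) (m≤n⇒m⊓n≡m (mantel G tf)) ⟩
  1 * w 0 + N * w 1 + E * w 2
    ≡⟨ cong (λ s → ⟦ s ⟧ * w 0 + N * w 1 + E * w 2) eq ⟨
  ⟦ face? G ∅ ⟧ * w 0 + N * w 1 + E * w 2
    ≡⟨ enumerate-graph G small w ⟨
  enumerate G w ∎
  where
  N = numVertices G
  E = numEdges G

⊑-triangleFree : ∀ {n} {G H : Complex n} → G ⊑ H → TriangleFree H → TriangleFree G
⊑-triangleFree G⊑H tf x y z (x≢y , xy) (x≢z , xz) (y≢z , yz) =
  tf x y z (x≢y , G⊑H _ xy) (x≢z , G⊑H _ xz) (y≢z , G⊑H _ yz)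

compress-graph : ∀ {n} {Γ : Complex n} → (∀ σ → Face Γ σ → ∣ σ ∣ ≤ 2) → TriangleFree Γ →
                 Compression Γ 2
compress-graph {Γ = Γ} small tf = record
  { colour   = vertexParity
  ; compress = compressGraph
  ; mono     = λ {Δ} {Δ′} → compressGraph-mono {G = Δ} {Δ′}
  ; nonvoid  = proj₁
  ; proper   = λ _ σ (_ , s) → inSegment-parity σ s
  ; faces    = λ {Δ} Δ⊑Γ → enumerate-compressGraph Δ (λ σ σ∈Δ → small σ (Δ⊑Γ σ σ∈Δ))
      (⊑-triangleFree {G = Δ} {Γ} Δ⊑Γ tf)
  }

++-⊆ : ∀ {m n} {σ τ : Subset m} {σ′ τ′ : Subset n} → τ ⊆ σ → τ′ ⊆ σ′ → τ Vec.++ τ′ ⊆ σ Vec.++ σ′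
++-⊆ {σ = []}    {[]}    _   τ′⊆σ′ x∈         = τ′⊆σ′ x∈
++-⊆ {σ = _ ∷ σ} {_ ∷ τ} τ⊆σ τ′⊆σ′ here       = case τ⊆σ here of λ { here → here }
++-⊆ {σ = _ ∷ σ} {_ ∷ τ} τ⊆σ τ′⊆σ′ (there x∈) = there (++-⊆ (drop-∷-⊆ τ⊆σ) τ′⊆σ′ x∈)

∈-take : ∀ {m n} {u : Fin m} (σ : Subset (m + n)) → u ↑ˡ n ∈ σ → u ∈ Vec.take m σ
∈-take {u = zero}  (inside ∷ σ) here       = here
∈-take {u = suc u} (_ ∷ σ)      (there u∈) = there (∈-take σ u∈)

∈-drop : ∀ m {n} {v : Fin n} (σ : Subset (m + n)) → m ↑ʳ v ∈ σ → v ∈ Vec.drop m σ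
∈-drop zero    σ       v∈         = v∈
∈-drop (suc m) (_ ∷ σ) (there v∈) = ∈-drop m σ v∈

module _ m {n} {σ τ : Subset (m + n)} (τ⊆σ : τ ⊆ σ) where

  private
    split⊆ : Vec.take m τ Vec.++ Vec.drop m τ ⊆ Vec.take m σ Vec.++ Vec.drop m σ
    split⊆ = subst₂ _⊆_ (sym (Vec.take++drop≡id m τ)) (sym (Vec.take++drop≡id m σ)) τ⊆σ

  take-⊆ : Vec.take m τ ⊆ Vec.take m σ
  take-⊆ = ⊆-++ˡ (Vec.take m τ) (Vec.take m σ) split⊆

  drop-⊆ : Vec.drop m τ ⊆ Vec.drop m σ
  drop-⊆ = ⊆-++ʳ (Vec.take m τ) (Vec.take m σ) split⊆

∣++∣ : ∀ {m n} (σ : Subset m) (τ : Subset n) → ∣ σ Vec.++ τ ∣ ≡ ∣ σ ∣ + ∣ τ ∣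
∣++∣ []            τ = refl
∣++∣ (outside ∷ σ) τ = ∣++∣ σ τ
∣++∣ (inside ∷ σ)  τ = cong suc (∣++∣ σ τ)

⋆-faces : ∀ {m n} (Γ₁ : Complex m) (Γ₂ : Complex n) σ τ →
          Face (Γ₁ ⋆ Γ₂) (σ Vec.++ τ) → Face Γ₁ σ × Face Γ₂ τ
⋆-faces Γ₁ Γ₂ σ τ (σ′ , τ′ , σ′∈ , τ′∈ , eq) with Vec.++-injective σ σ′ eq
... | refl , refl = σ′∈ , τ′∈

slice : ∀ {m n} → Complex (m + n) → Subset m → Complex n
slice Δ σ = record
  { Face   = λ τ → Face Δ (σ Vec.++ τ)
  ; face?  = λ τ → face? Δ (σ Vec.++ τ)
  ; closed = λ τ′⊆τ → closed Δ (++-⊆ {σ = σ} ⊆-refl τ′⊆τ)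
  }

module _ {n₁ n₂ r₁ r₂} {Γ₁ : Complex n₁} {Γ₂ : Complex n₂}
         (C₁ : Compression Γ₁ r₁) (C₂ : Compression Γ₂ r₂) where

  private
    module C₁ = Compression C₁
    module C₂ = Compression C₂

  -- The faces of Γ₁ over τ, after compression in the direction of Γ₂.
  column : Complex (n₁ + n₂) → Subset C₂.size → Complex n₁
  column Δ τ = record
    { Face   = λ σ → Face (C₂.compress (slice Δ σ)) τ
    ; face?  = λ σ → face? (C₂.compress (slice Δ σ)) τ
    ; closed = λ {σ} {σ′} σ′⊆σ → C₂.mono {slice Δ σ} {slice Δ σ′}
        (λ ρ → closed Δ (++-⊆ {τ = σ′} σ′⊆σ ⊆-refl)) τ
    }

  compress⋆ : Complex (n₁ + n₂) → Complex (C₁.size + C₂.size)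
  compress⋆ Δ = record
    { Face   = λ σ → Face (C₁.compress (column Δ (Vec.drop C₁.size σ))) (Vec.take C₁.size σ)
    ; face?  = λ σ → face? (C₁.compress (column Δ (Vec.drop C₁.size σ))) (Vec.take C₁.size σ)
    ; closed = λ {σ} {σ′} σ′⊆σ σ∈ →
        C₁.mono {column Δ (Vec.drop C₁.size σ)} {column Δ (Vec.drop C₁.size σ′)}
          (λ ρ → closed (C₂.compress (slice Δ ρ)) (drop-⊆ C₁.size σ′⊆σ)) _
          (closed (C₁.compress (column Δ (Vec.drop C₁.size σ))) (take-⊆ C₁.size σ′⊆σ) σ∈)
    }

  colour⋆ : Fin (C₁.size + C₂.size) → Fin (r₁ + r₂)
  colour⋆ u = [ (λ v → C₁.colour v ↑ˡ r₂) , (λ v → r₁ ↑ʳ C₂.colour v) ]′ (Fin.splitAt C₁.size u)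

  module _ {Δ : Complex (n₁ + n₂)} (Δ⊑Γ : Δ ⊑ (Γ₁ ⋆ Γ₂)) where

    slice-⊑ : ∀ σ → slice Δ σ ⊑ Γ₂
    slice-⊑ σ τ στ∈ = proj₂ (⋆-faces Γ₁ Γ₂ σ τ (Δ⊑Γ _ στ∈))

    column-⊑ : ∀ τ → column Δ τ ⊑ Γ₁
    column-⊑ τ σ σ∈ = proj₁ (⋆-faces Γ₁ Γ₂ σ ∅ (Δ⊑Γ _ (C₂.nonvoid {slice Δ σ} σ∈)))

    proper⋆ : ProperColoring (r₁ + r₂) (compress⋆ Δ) colour⋆
    proper⋆ σ σ∈ u v u∈σ v∈σ u≢v
      with Fin.splitAt C₁.size u in equ | Fin.splitAt C₁.size v in eqv
    ... | inj₁ u′ | inj₁ v′ = λ eq → C₁.proper (column-⊑ _) _ σ∈ u′ v′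
      (∈-take σ (subst (_∈ σ) (sym u≡) u∈σ)) (∈-take σ (subst (_∈ σ) (sym v≡) v∈σ))
      (λ u′≡v′ → u≢v (trans (sym u≡) (trans (cong (_↑ˡ C₂.size) u′≡v′) v≡)))
      (Fin.↑ˡ-injective r₂ _ _ eq)
      where
      u≡ = Fin.splitAt⁻¹-↑ˡ equ
      v≡ = Fin.splitAt⁻¹-↑ˡ eqv
    ... | inj₁ u′ | inj₂ v′ = λ eq →
      case trans (sym (Fin.splitAt-↑ˡ r₁ _ r₂)) (trans (cong (Fin.splitAt r₁) eq) (Fin.splitAt-↑ʳ r₁ r₂ _))
      of λ ()
    ... | inj₂ u′ | inj₁ v′ = λ eq →
      case trans (sym (Fin.splitAt-↑ˡ r₁ _ r₂)) (trans (cong (Fin.splitAt r₁) (sym eq)) (Fin.splitAt-↑ʳ r₁ r₂ _))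
      of λ ()
    ... | inj₂ u′ | inj₂ v′ = λ eq → C₂.proper (slice-⊑ ∅) _
      (C₁.nonvoid {column Δ (Vec.drop C₁.size σ)} σ∈) u′ v′
      (∈-drop C₁.size σ (subst (_∈ σ) (sym u≡) u∈σ)) (∈-drop C₁.size σ (subst (_∈ σ) (sym v≡) v∈σ))
      (λ u′≡v′ → u≢v (trans (sym u≡) (trans (cong (C₁.size ↑ʳ_) u′≡v′) v≡)))
      (Fin.↑ʳ-injective r₁ _ _ eq)
      where
      u≡ = Fin.splitAt⁻¹-↑ʳ equ
      v≡ = Fin.splitAt⁻¹-↑ʳ eqv

    faces⋆ : ∀ w → enumerate (compress⋆ Δ) w ≡ enumerate Δ w
    faces⋆ w = begin-equality
      enumerate (compress⋆ Δ) w
        ≡⟨ ∑⊆-++ C₁.size _ ⟩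
      ∑⊆ C₁.size (λ σ → ∑⊆ C₂.size (λ τ →
        ⟦ face? (compress⋆ Δ) (σ Vec.++ τ) ⟧ * w ∣ σ Vec.++ τ ∣))
        ≡⟨ ∑⊆-cong {C₁.size} (λ σ → ∑⊆-cong {C₂.size} (λ τ → split σ τ)) ⟩
      ∑⊆ C₁.size (λ σ → ∑⊆ C₂.size (λ τ →
        ⟦ face? (C₁.compress (column Δ τ)) σ ⟧ * w (∣ σ ∣ + ∣ τ ∣)))
        ≡⟨ ∑⊆-comm {C₁.size} {C₂.size} _ ⟩
      ∑⊆ C₂.size (λ τ → ∑⊆ C₁.size (λ σ →
        ⟦ face? (C₁.compress (column Δ τ)) σ ⟧ * w (∣ σ ∣ + ∣ τ ∣)))
        ≡⟨ ∑⊆-cong {C₂.size} (λ τ → C₁.faces (column-⊑ τ) (λ s → w (s + ∣ τ ∣))) ⟩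
      ∑⊆ C₂.size (λ τ → ∑⊆ n₁ (λ σ →
        ⟦ face? (column Δ τ) σ ⟧ * w (∣ σ ∣ + ∣ τ ∣)))
        ≡⟨ ∑⊆-comm {C₂.size} {n₁} _ ⟩
      ∑⊆ n₁ (λ σ → ∑⊆ C₂.size (λ τ →
        ⟦ face? (C₂.compress (slice Δ σ)) τ ⟧ * w (∣ σ ∣ + ∣ τ ∣)))
        ≡⟨ ∑⊆-cong {n₁} (λ σ → C₂.faces (slice-⊑ σ) (λ s → w (∣ σ ∣ + s))) ⟩
      ∑⊆ n₁ (λ σ → ∑⊆ n₂ (λ τ → ⟦ face? Δ (σ Vec.++ τ) ⟧ * w (∣ σ ∣ + ∣ τ ∣)))
        ≡⟨ ∑⊆-cong {n₁} (λ σ → ∑⊆-cong {n₂} (λ τ →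
             cong (λ s → ⟦ face? Δ (σ Vec.++ τ) ⟧ * w s) (∣++∣ σ τ))) ⟨
      ∑⊆ n₁ (λ σ → ∑⊆ n₂ (λ τ → ⟦ face? Δ (σ Vec.++ τ) ⟧ * w ∣ σ Vec.++ τ ∣))
        ≡⟨ ∑⊆-++ n₁ _ ⟨
      enumerate Δ w ∎
      where
      split : ∀ σ τ → ⟦ face? (compress⋆ Δ) (σ Vec.++ τ) ⟧ * w ∣ σ Vec.++ τ ∣ ≡
                      ⟦ face? (C₁.compress (column Δ τ)) σ ⟧ * w (∣ σ ∣ + ∣ τ ∣)
      split σ τ with Vec.++-injective _ σ (Vec.take++drop≡id C₁.size (σ Vec.++ τ))
      ... | take≡σ , drop≡τ = cong₂ _*_
        (cong₂ (λ ρ π → ⟦ face? (C₁.compress (column Δ π)) ρ ⟧) take≡σ drop≡τ)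
        (cong w (∣++∣ σ τ))

  compress-⋆ : Compression (Γ₁ ⋆ Γ₂) (r₁ + r₂)
  compress-⋆ = record
    { colour   = colour⋆
    ; compress = compress⋆
    ; mono     = λ {Δ} {Δ′} Δ⊑Δ′ σ →
        C₁.mono {column Δ (Vec.drop C₁.size σ)} {column Δ′ (Vec.drop C₁.size σ)}
          (λ ρ → C₂.mono {slice Δ ρ} {slice Δ′ ρ} (λ π → Δ⊑Δ′ (ρ Vec.++ π)) (Vec.drop C₁.size σ))
          (Vec.take C₁.size σ)
    ; nonvoid  = λ {Δ} {σ} σ∈ → closed Δ ⊥⊆
        (C₂.nonvoid {slice Δ ∅} (C₁.nonvoid {column Δ (Vec.drop C₁.size σ)} σ∈))
    ; proper   = λ {Δ} → proper⋆ {Δ}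
    ; faces    = λ {Δ} → faces⋆ {Δ}
    }

compress-｛∅｝ : Compression ｛∅｝ 0
compress-｛∅｝ = record
  { colour   = id
  ; compress = id
  ; mono     = id
  ; nonvoid  = λ {Δ} → closed Δ ⊥⊆
  ; proper   = λ _ _ _ ()
  ; faces    = λ _ _ → refl
  }

compress-join : ∀ {k} {n r : Vector ℕ k} {Γ : ∀ i → Complex (n i)} →
                (∀ i → Compression (Γ i) (r i)) → Compression (join Γ) (total r)
compress-join {zero}  C = compress-｛∅｝
compress-join {suc k} C = compress-⋆ (C zero) (compress-join (C ∘ suc))

HasFaceOfSize : ∀ {n} → Complex n → ℕ → Set
HasFaceOfSize Γ r = ∃[ σ ] Face Γ σ × ∣ σ ∣ ≡ r

join-face : ∀ {k} {n r : Vector ℕ k} {Γ : ∀ i → Complex (n i)} →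
            (∀ i → HasFaceOfSize (Γ i) (r i)) → HasFaceOfSize (join Γ) (total r)
join-face {zero}  σ = [] , tt , refl
join-face {suc k} {Γ = Γ} faces with faces zero | join-face {Γ = Γ ∘ suc} (faces ∘ suc)
... | σ , σ∈ , ∣σ∣ | τ , τ∈ , ∣τ∣ =
  σ Vec.++ τ , (σ , τ , σ∈ , τ∈ , refl) , trans (∣++∣ σ τ) (cong₂ _+_ ∣σ∣ ∣τ∣)

-- Dimensions and f-vectors

⊖1-cancel-≤ : ∀ {a b} → a ⊖ 1 ℤ.≤ b ⊖ 1 → a ≤ b
⊖1-cancel-≤ {zero}          _           = z≤n
⊖1-cancel-≤ {suc a} {zero}  ()
⊖1-cancel-≤ {suc a} {suc b} (ℤ.+≤+ a≤b) = s≤s a≤b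

⊖1-injective : ∀ {a b} → a ⊖ 1 ≡ b ⊖ 1 → a ≡ b
⊖1-injective eq =
  ≤-antisym (⊖1-cancel-≤ (ℤ.≤-reflexive eq)) (⊖1-cancel-≤ (ℤ.≤-reflexive (sym eq)))

module _ {n} (Γ : Complex n) d (dimΓ : HasDim Γ (d ⊖ 1)) where

  dim⇒size≤ : ∀ σ → Face Γ σ → ∣ σ ∣ ≤ d
  dim⇒size≤ σ σ∈Γ = ⊖1-cancel-≤ (proj₂ dimΓ σ σ∈Γ)

  dim⇒face : HasFaceOfSize Γ d
  dim⇒face = let (σ , σ∈Γ , eq) , _ = dimΓ in σ , σ∈Γ , ⊖1-injective eq

flag⇒triangleFree : ∀ {n} {Γ : Complex n} → (∀ σ → Face Γ σ → ∣ σ ∣ ≤ 2) → Flag Γ → TriangleFree Γ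
flag⇒triangleFree {Γ = Γ} small flag x y z xy xz yz = <⇒≱
  (three-elements {p = T} (x∈p∪q⁺ (inj₁ (x∈⁅x⁆ x)))
    (x∈p∪q⁺ {p = ⁅ x ⁆} (inj₂ (x∈p∪q⁺ (inj₁ (x∈⁅x⁆ y)))))
    (x∈p∪q⁺ {p = ⁅ x ⁆} (inj₂ (x∈p∪q⁺ {p = ⁅ y ⁆} (inj₂ (x∈⁅x⁆ z)))))
    (proj₁ xy) (proj₁ xz) (proj₁ yz))
  (small T (flag T (vertices , edges)))
  where
  T = ⁅ x ⁆ ∪ (⁅ y ⁆ ∪ ⁅ z ⁆)

  members : ∀ {v} → v ∈ T → v ≡ x ⊎ v ≡ y ⊎ v ≡ z
  members v∈T with x∈p∪q⁻ ⁅ x ⁆ (⁅ y ⁆ ∪ ⁅ z ⁆) v∈T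
  ... | inj₁ v∈x = inj₁ (x∈⁅y⁆⇒x≡y x v∈x)
  ... | inj₂ v∈yz with x∈p∪q⁻ ⁅ y ⁆ ⁅ z ⁆ v∈yz
  ...   | inj₁ v∈y = inj₂ (inj₁ (x∈⁅y⁆⇒x≡y y v∈y))
  ...   | inj₂ v∈z = inj₂ (inj₂ (x∈⁅y⁆⇒x≡y z v∈z))

  vertices : ∀ v → v ∈ T → Face Γ ⁅ v ⁆
  vertices v v∈T with members v∈T
  ... | inj₁ refl        = adjacent⇒vertex Γ (adjacent-sym Γ xy)
  ... | inj₂ (inj₁ refl) = adjacent⇒vertex Γ xy
  ... | inj₂ (inj₂ refl) = adjacent⇒vertex Γ xz

  edges : ∀ u v → u ∈ T → v ∈ T → u ≢ v → Adjacent Γ u v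
  edges u v u∈T v∈T u≢v with members u∈T | members v∈T
  ... | inj₁ refl        | inj₁ refl        = contradiction refl u≢v
  ... | inj₁ refl        | inj₂ (inj₁ refl) = xy
  ... | inj₁ refl        | inj₂ (inj₂ refl) = xz
  ... | inj₂ (inj₁ refl) | inj₁ refl        = adjacent-sym Γ xy
  ... | inj₂ (inj₁ refl) | inj₂ (inj₁ refl) = contradiction refl u≢v
  ... | inj₂ (inj₁ refl) | inj₂ (inj₂ refl) = yz
  ... | inj₂ (inj₂ refl) | inj₁ refl        = adjacent-sym Γ xz
  ... | inj₂ (inj₂ refl) | inj₂ (inj₁ refl) = adjacent-sym Γ yz
  ... | inj₂ (inj₂ refl) | inj₂ (inj₂ refl) = contradiction refl u≢v

length-filter-map : ∀ {a b p} {A : Set a} {B : Set b} {P : B → Set p}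
  (P? : ∀ y → Dec (P y)) (g : A → B) xs →
  List.length (List.filter P? (List.map g xs)) ≡ List.length (List.filter (P? ∘ g) xs)
length-filter-map P? g List.[] = refl
length-filter-map P? g (x List.∷ xs) with does (P? (g x))
... | inside  = cong suc (length-filter-map P? g xs)
... | outside = length-filter-map P? g xs

length-filter-subsets : ∀ {n p} {P : Subset n → Set p} (P? : ∀ σ → Dec (P σ)) →
  List.length (List.filter P? (subsets n)) ≡ ∑⊆ n (λ σ → ⟦ P? σ ⟧)
length-filter-subsets {zero} P? with does (P? [])
... | inside  = refl
... | outside = refl
length-filter-subsets {suc n} P? = begin-equality
  List.length (List.filter P? (outs List.++ ins))
    ≡⟨ cong List.length (List.filter-++ P? outs ins) ⟩
  List.length (List.filter P? outs List.++ List.filter P? ins)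
    ≡⟨ List.length-++ (List.filter P? outs) ⟩
  List.length (List.filter P? outs) + List.length (List.filter P? ins)
    ≡⟨ cong₂ _+_ (step outside) (step inside) ⟩
  ∑⊆ (suc n) (λ σ → ⟦ P? σ ⟧) ∎
  where
  outs = List.map (outside ∷_) (subsets n)
  ins  = List.map (inside ∷_) (subsets n)
  step : ∀ s → List.length (List.filter P? (List.map (s ∷_) (subsets n))) ≡
               ∑⊆ n (λ σ → ⟦ P? (s ∷ σ) ⟧)
  step s = trans (length-filter-map P? (s ∷_) (subsets n))
                 (length-filter-subsets (P? ∘ (s ∷_)))

f≡enumerate : ∀ {n} (Δ : Complex n) i → f Δ i ≡ enumerate Δ (λ s → ⟦ s ⊖ 1 ℤ.≟ i ⟧)
f≡enumerate {n} Δ i = trans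
  (length-filter-subsets (λ σ → face? Δ σ ×-dec (dimFace σ ℤ.≟ i)))
  (∑⊆-cong {n} (λ σ → ⟦⟧-× (face? Δ σ) (dimFace σ ℤ.≟ i)))

face⇒1≤f : ∀ {n} (Δ : Complex n) {σ i} → Face Δ σ → dimFace σ ≡ i → 1 ≤ f Δ i
face⇒1≤f Δ {σ} {i} σ∈Δ dimσ = begin
  1                                         ≡⟨ ⟦⟧-true (P? σ) (σ∈Δ , dimσ) ⟨
  ⟦ P? σ ⟧                                  ≤⟨ ∑⊆-≥ (λ σ → ⟦ P? σ ⟧) σ ⟩
  ∑⊆ _ (λ σ → ⟦ P? σ ⟧)                     ≡⟨ length-filter-subsets P? ⟨
  f Δ i                                     ∎
  where
  P? = λ σ → face? Δ σ ×-dec (dimFace σ ℤ.≟ i)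

1≤f⇒face : ∀ {n} (Δ : Complex n) {i} → 1 ≤ f Δ i → ∃[ σ ] Face Δ σ × dimFace σ ≡ i
1≤f⇒face Δ {i} 1≤f =
  let σ , pos = ∑⊆-positive (λ σ → ⟦ P? σ ⟧) (subst (1 ≤_) (length-filter-subsets P?) 1≤f)
  in σ , ⟦⟧≥1⇒ (P? σ) pos
  where
  P? = λ σ → face? Δ σ ×-dec (dimFace σ ℤ.≟ i)

hasDim-respects-f : ∀ {m n} {Θ : Complex m} {Δ : Complex n} → (∀ i → f Θ i ≡ f Δ i) →
                    ∀ {δ} → HasDim Δ δ → HasDim Θ δ
hasDim-respects-f {Θ = Θ} {Δ} f≗f {δ} ((σ , σ∈Δ , dimσ) , bound) =
  1≤f⇒face Θ (subst (1 ≤_) (sym (f≗f δ)) (face⇒1≤f Δ σ∈Δ dimσ)) ,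
  λ τ τ∈Θ → let ρ , ρ∈Δ , dimρ = 1≤f⇒face Δ (subst (1 ≤_) (f≗f (dimFace τ)) (face⇒1≤f Θ τ∈Θ refl))
            in subst (ℤ._≤ δ) dimρ (bound ρ ρ∈Δ)

theorem1p2 : ∀ {c ℓ₁ ℓ₂} (K : HeytingField c ℓ₁ ℓ₂) → CharZero K →
    ∀ (k : ℕ) → 1 ≤ k →
    (n : Fin k → ℕ) (Γ : ∀ i → Complex (n i)) →
    (∀ i → HasDim (Γ i) (+ 0) ⊎ HasDim (Γ i) (+ 1)) →
    (∀ i → Flag (Γ i)) →
    (∀ i → Bipartite (Γ i) ⊎ AlmostBipartite (Γ i)) →
    (d : ℕ) → HasDim (join Γ) (d ⊖ 1) →
    (Δ : Complex (total n)) → Δ ⊑ join Γ → HasDim Δ (d ⊖ 1) →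
    CohenMacaulay K Δ →
    ∃[ m ] Σ[ Θ ∈ Complex m ]
    HasDim Θ (d ⊖ 1) × Balanced Θ × fVector d Θ ≡ fVector d Δ
theorem1p2 K _ k _ n Γ dimΓ flag _ d dim-join Δ Δ⊑Γ dimΔ _ =
  C.size , Θ , dimΘ , (d , dimΘ , (λ v → inject≤ (C.colour v) r≤d) , proper) ,
  Vec.tabulate-cong (λ j → f≗f (Fin.toℕ j ⊖ 1))
  where
  factor : ∀ i → HasDim (Γ i) (+ 0) ⊎ HasDim (Γ i) (+ 1) →
           ∃[ r ] Compression (Γ i) r × HasFaceOfSize (Γ i) r
  factor i (inj₁ dim0) = 1 , compress-points (dim⇒size≤ (Γ i) 1 dim0) , dim⇒face (Γ i) 1 dim0
  factor i (inj₂ dim1) =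
    2 , compress-graph small (flag⇒triangleFree {Γ = Γ i} small (flag i)) , dim⇒face (Γ i) 2 dim1
    where
    small = dim⇒size≤ (Γ i) 2 dim1

  r : Fin k → ℕ
  r i = proj₁ (factor i (dimΓ i))

  module C = Compression (compress-join {r = r} {Γ} (λ i → proj₁ (proj₂ (factor i (dimΓ i)))))

  Θ = C.compress Δ

  r≤d : total r ≤ d
  r≤d with join-face {r = r} {Γ} (λ i → proj₂ (proj₂ (factor i (dimΓ i))))
  ... | σ , σ∈ , ∣σ∣≡r = subst (_≤ d) ∣σ∣≡r (dim⇒size≤ (join Γ) d dim-join σ σ∈)

  f≗f : ∀ i → f Θ i ≡ f Δ i
  f≗f i = trans (f≡enumerate Θ i) (trans (C.faces {Δ} Δ⊑Γ (λ s → ⟦ s ⊖ 1 ℤ.≟ i ⟧)) (sym (f≡enumerate Δ i)))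

  dimΘ : HasDim Θ (d ⊖ 1)
  dimΘ = hasDim-respects-f {Θ = Θ} {Δ} f≗f dimΔ

  proper : ProperColoring d Θ (λ v → inject≤ (C.colour v) r≤d)
  proper σ σ∈ u v u∈σ v∈σ u≢v eq =
    C.proper {Δ} Δ⊑Γ σ σ∈ u v u∈σ v∈σ u≢v (Fin.inject≤-injective r≤d r≤d _ _ eq)
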